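{- If $A$ is a valid formula, then (i) $\mathsf{D_C}\vdash^{<\varphi_2 0}_{0}A$, and (ii) $\mathsf{G_C}\vdash^{<\varphi_2 0}_{0}A$.
   Context: Fix $h\ge1$ agents. Formulas: $A::=p\mid\bar p\mid A\vee A\mid A\wedge A\mid\Diamond_iA\mid\Box_iA\mid\widetilde{\mathsf C}A\mid\mathsf CA$ ($1\le i\le h$), $\widetilde{\mathsf C}$ the De Morgan dual of $\mathsf C$; $\bar A$ by De Morgan laws. $\Box A:=\Box_1A\wedge\dots\wedge\Box_hA$, $\Diamond A:=\Diamond_1A\vee\dots\vee\Diamond_hA$, $\Box^k,\Diamond^k$ iterations. Validity: truth at all states of all Kripke models $(S,\to_1,\dots,\to_h,V)$, where $\Box_i,\Diamond_i$ are interpreted via $\to_i$ and $s\models\mathsf CA$ iff $t\models A$ for every $t$ reachable from $s$ by a path of length $\ge1$ in $\to_1\cup\dots\cup\to_h$ (dually for $\widetilde{\mathsf C}$); equivalently, provability in the standard Hilbert system for the multi-agent logic $\mathsf K$ with common knowledge. Nested sequents: finite multisets of formulas and boxed sequents $[\Delta]_i$; contexts $\Gamma\{\ \}$. System $\mathsf{D_C}$ (premises / conclusion): axiom $\Gamma\{p,\bar p\}$; $\wedge$: $\Gamma\{A\},\Gamma\{B\}/\Gamma\{A\wedge B\}$; $\vee$: $\Gamma\{A,B\}/\Gamma\{A\vee B\}$; $\Box_i$: $\Gamma\{[A]_i\}/\Gamma\{\Box_iA\}$; $\Diamond_i$: $\Gamma\{\Diamond_iA,[\Delta,A]_i\}/\Gamma\{\Diamond_iA,[\Delta]_i\}$;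 $\mathsf C$: premises $\Gamma\{\Box^kA\}$, all $k\ge1$ / $\Gamma\{\mathsf CA\}$; $\widetilde{\mathsf C}$: $\Gamma\{\widetilde{\mathsf C}A,\Diamond^kA\}/\Gamma\{\widetilde{\mathsf C}A\}$ (some $k\ge1$). A shallow sequent is a finite multiset of formulas; $\Diamond_i\Gamma$, $\widetilde{\mathsf C}\Gamma$ prefix each element. System $\mathsf{G_C}$: axiom $\Gamma,p,\bar p$; $\wedge$: $\Gamma,A$ and $\Gamma,B$ / $\Gamma,A\wedge B$; $\vee$: $\Gamma,A,B/\Gamma,A\vee B$; $\Box_i$: $\Gamma,\widetilde{\mathsf C}\Delta,A\,/\,\Diamond_i\Gamma,\widetilde{\mathsf C}\Delta,\Box_iA,\Sigma$; $\mathsf C$: premises $\Gamma,\Box^kA$ for all $k\ge1$ / $\Gamma,\mathsf CA$; $\widetilde{\mathsf C}$: $\Gamma,\widetilde{\mathsf C}A,\Diamond A/\Gamma,\widetilde{\mathsf C}A$. Proofs: well-founded possibly infinitely branching trees with axiom leaves; depth = least ordinal greater than depths of immediate subproofs. $\mathcal S\vdash^{<\alpha}_0 A$: there is a cut-free proof of $A$ in $\mathcal S$ of depth $<\alpha$. Veblen function: $\varphi_0\beta=\omega^\beta$; for $\alpha>0$, $\varphi_\alpha\beta$ is the $(\beta+1)$-th common fixpoint of $\xi\mapsto\varphi_\gamma\xi$ for all $\gamma<\alpha$; $\varphi_2 0$ is the least common fixpoint of $\xi\mapsto\varphi_0\xi$ and $\xi\mapsto\varphi_1\xi$. -}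

module Defs where

open import Data.Nat using (ℕ; zero; suc)
open import Data.Fin using (Fin; zero; suc)
open import Data.Bool using (Bool; true; false)
open import Data.List using (List; []; _∷_; _++_; map)
open import Data.Product using (_×_; Σ; ∃)
open import Data.Empty using (⊥)
open import Relation.Nullary using (¬_)
open import Relation.Binary.PropositionalEquality using (_≡_)
open import Data.List.Relation.Binary.Permutation.Propositional using (_↭_)

-- Ordinals: Brouwer trees (limits = suprema of ℕ-indexed sequences)

data Ord : Set where
  ozero : Ord
  osuc  : Ord → Ord
  olim  : (ℕ → Ord) → Ord

-- order on Brouwer trees (olim f is read as the supremum of f)
data _≤ₒ_ : Ord → Ord → Set where
  ≤-zero     : ∀ {x} → ozero ≤ₒ x
  ≤-suc      : ∀ {x y} → x ≤ₒ y → osuc x ≤ₒ osuc y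
  ≤-cocone   : ∀ {x f} k → x ≤ₒ f k → x ≤ₒ olim f
  ≤-limiting : ∀ {f x} → (∀ k → f k ≤ₒ x) → olim f ≤ₒ x

_<ₒ_ : Ord → Ord → Set
x <ₒ y = osuc x ≤ₒ y

osup2 : Ord → Ord → Ord
osup2 a b = olim (λ { zero → a ; (suc _) → b })

_+ₒ_ : Ord → Ord → Ord
a +ₒ ozero  = a
a +ₒ osuc b = osuc (a +ₒ b)
a +ₒ olim f = olim (λ n → a +ₒ f n)

_·ₙ_ : Ord → ℕ → Ord
a ·ₙ zero  = ozero
a ·ₙ suc n = (a ·ₙ n) +ₒ a

ω^ : Ord → Ord
ω^ ozero    = osuc ozero
ω^ (osuc b) = olim (λ n → ω^ b ·ₙ n)
ω^ (olim f) = olim (λ n → ω^ (f n))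

iter : (Ord → Ord) → ℕ → Ord → Ord
iter f zero    x = x
iter f (suc n) x = f (iter f n x)

-- Veblen functions φ_k for finite k:  φ_0 β = ω^β, φ_{k+1} enumerates the
-- fixpoints of φ_k (= common fixpoints of all φ_j, j ≤ k).
φ : ℕ → Ord → Ord
φ zero          = ω^
φ (suc k) ozero    = olim (λ n → iter (φ k) n ozero)
φ (suc k) (osuc b) = olim (λ n → iter (φ k) n (osuc (φ (suc k) b)))
φ (suc k) (olim f) = olim (λ n → φ (suc k) (f n))

-- Formulas (h agents, indexed by Fin h; atoms indexed by ℕ)

infixr 6 _∧'_
infixr 5 _∨'_

data Fm (h : ℕ) : Set where
  pos neg   : ℕ → Fm h
  _∨'_ _∧'_ : Fm h → Fm h → Fm h
  ◇ᵢ □ᵢ     : Fin h → Fm h → Fm h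
  C̃ C       : Fm h → Fm h

bigAnd : ∀ {h m} → (Fin (suc m) → Fm h) → Fm h
bigAnd {m = zero}  f = f zero
bigAnd {m = suc m} f = f zero ∧' bigAnd (λ i → f (suc i))

bigOr : ∀ {h m} → (Fin (suc m) → Fm h) → Fm h
bigOr {m = zero}  f = f zero
bigOr {m = suc m} f = f zero ∨' bigOr (λ i → f (suc i))

□ : ∀ {m} → Fm (suc m) → Fm (suc m)
□ A = bigAnd (λ i → □ᵢ i A)

◇ : ∀ {m} → Fm (suc m) → Fm (suc m)
◇ A = bigOr (λ i → ◇ᵢ i A)

□^ : ∀ {m} → ℕ → Fm (suc m) → Fm (suc m)
□^ zero    A = A
□^ (suc k) A = □ (□^ k A)

◇^ : ∀ {m} → ℕ → Fm (suc m) → Fm (suc m)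
◇^ zero    A = A
◇^ (suc k) A = ◇ (◇^ k A)

-- Kripke semantics (classical reading: ∨ and ∃ are ¬¬-stable)

record Model (h : ℕ) : Set₁ where
  field
    S : Set
    R : Fin h → S → S → Set
    V : ℕ → S → Bool

module _ {h : ℕ} (M : Model h) where
  open Model M

  data Reach : S → S → Set where
    one  : ∀ {s t} i → R i s t → Reach s t
    more : ∀ {s t u} i → R i s t → Reach t u → Reach s u

  _⊨_ : S → Fm h → Set
  s ⊨ pos p    = V p s ≡ true
  s ⊨ neg p    = V p s ≡ false
  s ⊨ (A ∨' B) = ¬ ((¬ (s ⊨ A)) × (¬ (s ⊨ B)))
  s ⊨ (A ∧' B) = (s ⊨ A) × (s ⊨ B)
  s ⊨ ◇ᵢ i A   = ¬ (∀ t → R i s t → ¬ (t ⊨ A))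
  s ⊨ □ᵢ i A   = ∀ t → R i s t → t ⊨ A
  s ⊨ C̃ A      = ¬ (∀ t → Reach s t → ¬ (t ⊨ A))
  s ⊨ C A      = ∀ t → Reach s t → t ⊨ A

Valid : ∀ {h} → Fm h → Set₁
Valid {h} A = (M : Model h) (s : Model.S M) → _⊨_ M s A

-- Nested sequents (multisets modelled as lists up to nested permutation)

mutual
  data Item (h : ℕ) : Set where
    fm  : Fm h → Item h
    box : Fin h → List (Item h) → Item h

  NSeq : ℕ → Set
  NSeq h = List (Item h)

mutual
  data _≈S_ {h : ℕ} : NSeq h → NSeq h → Set where
    []    : [] ≈S []
    cons  : ∀ {x y xs ys} → x ≈I y → xs ≈S ys → (x ∷ xs) ≈S (y ∷ ys)
    swap  : ∀ {x y xs} → (x ∷ y ∷ xs) ≈S (y ∷ x ∷ xs)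
    trans : ∀ {xs ys zs} → xs ≈S ys → ys ≈S zs → xs ≈S zs

  data _≈I_ {h : ℕ} : Item h → Item h → Set where
    fm  : ∀ {A} → fm A ≈I fm A
    box : ∀ {i Δ Δ'} → Δ ≈S Δ' → box i Δ ≈I box i Δ'

data Ctx (h : ℕ) : Set where
  hole  : NSeq h → Ctx h
  inBox : NSeq h → Fin h → Ctx h → Ctx h

plug : ∀ {h} → Ctx h → NSeq h → NSeq h
plug (hole Γ)      Δ = Γ ++ Δ
plug (inBox Γ i c) Δ = Γ ++ (box i (plug c Δ) ∷ [])

data DPf {m : ℕ} : NSeq (suc m) → Set where
  ax   : ∀ {Γ} (c : Ctx (suc m)) p →
         Γ ≈S plug c (fm (pos p) ∷ fm (neg p) ∷ []) → DPf Γ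
  ∧r   : ∀ {Γ} (c : Ctx (suc m)) A B →
         Γ ≈S plug c (fm (A ∧' B) ∷ []) →
         DPf (plug c (fm A ∷ [])) → DPf (plug c (fm B ∷ [])) → DPf Γ
  ∨r   : ∀ {Γ} (c : Ctx (suc m)) A B →
         Γ ≈S plug c (fm (A ∨' B) ∷ []) →
         DPf (plug c (fm A ∷ fm B ∷ [])) → DPf Γ
  □r   : ∀ {Γ} (c : Ctx (suc m)) i A →
         Γ ≈S plug c (fm (□ᵢ i A) ∷ []) →
         DPf (plug c (box i (fm A ∷ []) ∷ [])) → DPf Γ
  ◇r   : ∀ {Γ} (c : Ctx (suc m)) i A Δ →
         Γ ≈S plug c (fm (◇ᵢ i A) ∷ box i Δ ∷ []) →
         DPf (plug c (fm (◇ᵢ i A) ∷ box i (fm A ∷ Δ) ∷ [])) → DPf Γ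
  Cr   : ∀ {Γ} (c : Ctx (suc m)) A →
         Γ ≈S plug c (fm (C A) ∷ []) →
         ((k : ℕ) → DPf (plug c (fm (□^ (suc k) A) ∷ []))) → DPf Γ
  C̃r   : ∀ {Γ} (c : Ctx (suc m)) A (k : ℕ) →
         Γ ≈S plug c (fm (C̃ A) ∷ []) →
         DPf (plug c (fm (C̃ A) ∷ fm (◇^ (suc k) A) ∷ [])) → DPf Γ

ddepth : ∀ {m} {Γ : NSeq (suc m)} → DPf Γ → Ord
ddepth (ax _ _ _)           = ozero
ddepth (∧r _ _ _ _ d e)     = osup2 (osuc (ddepth d)) (osuc (ddepth e))
ddepth (∨r _ _ _ _ d)       = osuc (ddepth d)
ddepth (□r _ _ _ _ d)       = osuc (ddepth d)
ddepth (◇r _ _ _ _ _ d)     = osuc (ddepth d)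
ddepth (Cr _ _ _ ds)        = olim (λ k → osuc (ddepth (ds k)))
ddepth (C̃r _ _ _ _ d)       = osuc (ddepth d)

Seq : ℕ → Set
Seq h = List (Fm h)

data GPf {m : ℕ} : Seq (suc m) → Set where
  ax   : ∀ {Γ} Δ p → Γ ↭ (pos p ∷ neg p ∷ Δ) → GPf Γ
  ∧r   : ∀ {Γ} Δ A B → Γ ↭ ((A ∧' B) ∷ Δ) →
         GPf (A ∷ Δ) → GPf (B ∷ Δ) → GPf Γ
  ∨r   : ∀ {Γ} Δ A B → Γ ↭ ((A ∨' B) ∷ Δ) →
         GPf (A ∷ B ∷ Δ) → GPf Γ
  □r   : ∀ {Γ'} (Γ Δ Σ : Seq (suc m)) i A →
         Γ' ↭ (map (◇ᵢ i) Γ ++ map C̃ Δ ++ (□ᵢ i A ∷ Σ)) →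
         GPf (Γ ++ map C̃ Δ ++ (A ∷ [])) → GPf Γ'
  Cr   : ∀ {Γ} Δ A → Γ ↭ (C A ∷ Δ) →
         ((k : ℕ) → GPf (□^ (suc k) A ∷ Δ)) → GPf Γ
  C̃r   : ∀ {Γ} Δ A → Γ ↭ (C̃ A ∷ Δ) →
         GPf (C̃ A ∷ ◇ A ∷ Δ) → GPf Γ

gdepth : ∀ {m} {Γ : Seq (suc m)} → GPf Γ → Ord
gdepth (ax _ _ _)             = ozero
gdepth (∧r _ _ _ _ d e)       = osup2 (osuc (gdepth d)) (osuc (gdepth e))
gdepth (∨r _ _ _ _ d)         = osuc (gdepth d)
gdepth (□r _ _ _ _ _ _ d)     = osuc (gdepth d)
gdepth (Cr _ _ _ ds)          = olim (λ k → osuc (gdepth (ds k)))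
gdepth (C̃r _ _ _ d)           = osuc (gdepth d)

D⊢<_∣_ : ∀ {m} → Ord → Fm (suc m) → Set
D⊢< α ∣ A = Σ (DPf (fm A ∷ [])) (λ d → ddepth d <ₒ α)

G⊢<_∣_ : ∀ {m} → Ord → Fm (suc m) → Set
G⊢< α ∣ A = Σ (GPf (A ∷ [])) (λ d → gdepth d <ₒ α)

{-# OPTIONS --safe #-}
module Submission where

-- A is proved with depth below ω² by eliminating states of a finite model, in the style of Pratt.
-- A state is a subset of the closure of A, read as a sequent, and is meant to falsify its formulas.
-- It is eliminated when it clashes, when it lacks a successor for one of its □-formulas, or when it
-- contains some C B but reaches no state falsifying B. Eliminated states are provable: in the last
-- case the states reaching no such state are closed under successors, so by induction on k each of
-- them is provable together with □^k B, and the C rule applies; a round thus costs ω steps.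
-- The surviving states form a Kripke model, so for valid A none of them falsifies A.
-- In D_C, C̃-formulas are not copied into boxes; instead C̃ B is used at an ancestor at distance d
-- of the current node, and the resulting ◇^(d+1) B is pushed down along the path.

open import Defs
open import Data.Nat as ℕ using (ℕ; zero; suc; _+_; _<_; z≤n; s≤s)
import Data.Nat.Properties as ℕ
open import Data.Nat.Induction using (<-wellFounded)
open import Induction.WellFounded using (Acc; acc)
open import Data.Fin using (Fin; zero; suc)
import Data.Fin.Properties as Fin
open import Data.Bool using (true; false)
open import Data.List using (List; []; _∷_; _++_; [_]; map; filter; concatMap; tabulate; length; cartesianProductWith; deduplicate)
import Data.List.Properties as List
open import Data.List.Membership.Propositional using (_∈_; _∉_; find; lose)
open import Data.List.Membership.Propositional.Properties using (∈-∃++; ∈-++⁺ˡ; ∈-++⁺ʳ; ∈-++⁻; ∈-map⁺; ∈-map⁻; ∈-filter⁺; ∈-filter⁻; ∈-tabulate⁺; ∈-tabulate⁻; ∈-cartesianProductWith⁺; ∈-cartesianProductWith⁻; ∈-deduplicate⁺; ∈-deduplicate⁻; ∈-concatMap⁺; ∈-concatMap⁻)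
open import Data.List.Relation.Unary.Any as Any using (Any; here; there)
import Data.List.Relation.Unary.Any.Properties as Any
open import Data.List.Relation.Unary.All as All using (All; []; _∷_)
import Data.List.Relation.Unary.All.Properties as All
open import Data.List.Relation.Binary.Subset.Propositional using (_⊆_)
import Data.List.Relation.Binary.Subset.Propositional.Properties as ⊆
open import Data.List.Relation.Unary.Unique.Propositional using (Unique; []; _∷_)
import Data.List.Relation.Unary.Unique.Propositional.Properties as Unique
import Data.List.Relation.Unary.Unique.DecPropositional.Properties as DecUnique
open import Data.List.Relation.Binary.Permutation.Propositional using (_↭_; ↭-refl; ↭-sym; ↭-trans; ↭-reflexive; prep; swap; refl; trans)
import Data.List.Relation.Binary.Permutation.Propositional.Properties as ↭
open import Data.Product using (_×_; _,_; proj₁; proj₂; Σ; ∃; ∃₂)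
open import Data.Sum using (_⊎_; inj₁; inj₂; [_,_]′)
open import Data.Empty using (⊥; ⊥-elim)
open import Function using (_∘_; id)
open import Relation.Nullary using (¬_; Dec; yes; no; does; contradiction)
open import Relation.Nullary.Decidable using (map′; _×-dec_; _⊎-dec_; ¬?)
open import Relation.Unary using (Decidable)
open import Relation.Binary.Definitions using (DecidableEquality)
open import Relation.Binary.PropositionalEquality as ≡ using (_≡_; _≢_; cong; cong₂; subst)

-- Ordinal bounds

≤ₒ-refl : ∀ {a} → a ≤ₒ a
≤ₒ-refl {ozero}  = ≤-zero
≤ₒ-refl {osuc a} = ≤-suc ≤ₒ-refl
≤ₒ-refl {olim f} = ≤-limiting λ k → ≤-cocone k ≤ₒ-refl

-- The constructor `≤-limiting` need not be the outermost one, so the bound is recovered below any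
-- chain of `≤-cocone`.
olim-inv : ∀ {f x} → olim f ≤ₒ x → ∀ k → f k ≤ₒ x
olim-inv (≤-cocone j le) k = ≤-cocone j (olim-inv le k)
olim-inv (≤-limiting le) k = le k

≤ₒ-trans : ∀ {a b c} → a ≤ₒ b → b ≤ₒ c → a ≤ₒ c
≤ₒ-trans ≤-zero           q                = ≤-zero
≤ₒ-trans (≤-limiting p)   q                = ≤-limiting λ k → ≤ₒ-trans (p k) q
≤ₒ-trans (≤-cocone k p)   q                = ≤ₒ-trans p (olim-inv q k)
≤ₒ-trans (≤-suc p)        (≤-suc q)        = ≤-suc (≤ₒ-trans p q)
≤ₒ-trans (≤-suc p)        (≤-cocone k q)   = ≤-cocone k (≤ₒ-trans (≤-suc p) q)

infixl 22 _↑_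
_↑_ : Ord → ℕ → Ord
a ↑ zero  = a
a ↑ suc k = osuc (a ↑ k)

↑-mono : ∀ {a b} k → a ≤ₒ b → a ↑ k ≤ₒ b ↑ k
↑-mono zero    le = le
↑-mono (suc k) le = ≤-suc (↑-mono k le)

≤-suc-right : ∀ {a b} → a ≤ₒ b → a ≤ₒ osuc b
≤-suc-right ≤-zero          = ≤-zero
≤-suc-right (≤-suc le)      = ≤-suc (≤-suc-right le)
≤-suc-right (≤-cocone k le) = ≤ₒ-trans (≤-suc-right le) (≤-suc (≤-cocone k ≤ₒ-refl))
≤-suc-right (≤-limiting le) = ≤-limiting λ k → ≤-suc-right (le k)

↑-monoʳ : ∀ {a j k} → j ℕ.≤ k → a ↑ j ≤ₒ a ↑ k
↑-monoʳ {k = zero}  z≤n     = ≤ₒ-refl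
↑-monoʳ {k = suc k} z≤n     = ≤-suc-right (↑-monoʳ {k = k} z≤n)
↑-monoʳ             (s≤s p) = ≤-suc (↑-monoʳ p)

infix 25 ω·_
-- The same ordinal as `ω^ (osuc ozero) ·ₙ n`, presented by limits of iterated successors so that
-- depth bounds involve no ordinal addition.
ω·_ : ℕ → Ord
ω· zero  = ozero
ω· suc n = olim (ω· n ↑_)

-- Finitely branching rules change only the offset; a rule with infinitely many premises raises `n`.
record Stage (n : ℕ) (a : Ord) : Set where
  constructor stage
  field
    offset : ℕ
    bound  : a ≤ₒ ω· n ↑ offset

stage-zero : ∀ {n} → Stage n ozero
stage-zero = stage 0 ≤-zero

stage-suc : ∀ {n a} → Stage n a → Stage n (osuc a)
stage-suc (stage k le) = stage (suc k) (≤-suc le)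

stage-sup2 : ∀ {n a b} → Stage n a → Stage n b → Stage n (osup2 a b)
stage-sup2 (stage j p) (stage k q) = stage (j + k) (≤-limiting λ where
  zero    → ≤ₒ-trans p (↑-monoʳ (ℕ.m≤m+n j k))
  (suc _) → ≤ₒ-trans q (↑-monoʳ (ℕ.m≤n+m k j)))

-- The offsets may be unbounded in `k`, but each bound lies below the next multiple of ω, which
-- therefore bounds the limit with offset 0.
stage-lim : ∀ {n f} → (∀ k → Stage n (f k)) → Stage (suc n) (olim f)
stage-lim s = stage 0 (≤-limiting λ k → let open Stage (s k) in ≤-cocone offset bound)

stage-mono : ∀ {n a} → Stage n a → Stage (suc n) a
stage-mono (stage k le) = stage k (≤ₒ-trans le (↑-mono k (≤-cocone 0 ≤ₒ-refl)))

ω·-≤ : ∀ n → ω· n ≤ₒ (ω^ (osuc ozero) ·ₙ n)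
ω·-≤ zero    = ≤-zero
ω·-≤ (suc n) = ≤-limiting λ k → ≤-cocone k (finite k)
  where
  finite : ∀ k → ω· n ↑ k ≤ₒ ((ω^ (osuc ozero) ·ₙ n) +ₒ (osuc ozero ·ₙ k))
  finite zero    = ω·-≤ n
  finite (suc k) = ≤-suc (finite k)

stage-<φ₂0 : ∀ {n a} → Stage n a → a <ₒ φ 2 ozero
stage-<φ₂0 {n} (stage k le) =
  ≤ₒ-trans (≤-suc le) (≤ₒ-trans (≤-cocone (suc k) ≤ₒ-refl) (≤ₒ-trans (ω·-≤ (suc n)) 
    -- The indices pick φ_1 0 in the limit for φ_2 0, then ω^(ω^1) in the limit for φ_1 0, then ω^2,
    -- then ω · (n + 1).
    (≤-cocone 1 (≤-cocone 3 (≤-cocone 2 (≤-cocone (suc n) ≤ₒ-refl))))))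

-- Lists

module _ {a} {A : Set a} where

  ∈⇒↭ : ∀ {x : A} {xs} → x ∈ xs → ∃ λ ys → xs ↭ x ∷ ys
  ∈⇒↭ x∈ with ys , zs , ≡.refl ← ∈-∃++ x∈ = ys ++ zs , ↭.shift _ ys zs

  -- Uniqueness turns inclusion of sets into inclusion of multisets: each element of `xs` uses up
  -- its own occurrence in `ys`.
  unique-⊆⇒↭ : ∀ {xs ys : List A} → Unique xs → xs ⊆ ys → ∃ λ zs → ys ↭ xs ++ zs
  unique-⊆⇒↭ {[]}     {ys} _       _  = ys , ↭-refl
  unique-⊆⇒↭ {x ∷ xs} (x∉ ∷ u) le with ∈⇒↭ (le (here ≡.refl))
  ... | ys′ , p with unique-⊆⇒↭ u xs⊆
    where
    xs⊆ : xs ⊆ ys′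
    xs⊆ y∈ with ↭.∈-resp-↭ p (le (there y∈))
    ... | here y≡x  = contradiction (≡.sym y≡x) (All.lookup x∉ y∈)
    ... | there y∈′ = y∈′
  ...   | zs , q = zs , ↭-trans p (prep x q)

  sublists : List A → List (List A)
  sublists []       = [ [] ]
  sublists (x ∷ xs) = sublists xs ++ map (x ∷_) (sublists xs)

  filter-∈-sublists : ∀ {p} {P : A → Set p} (P? : Decidable P) xs → filter P? xs ∈ sublists xs
  filter-∈-sublists P? []       = here ≡.refl
  filter-∈-sublists P? (x ∷ xs) with does (P? x)
  ... | true  = ∈-++⁺ʳ (sublists xs) (∈-map⁺ (x ∷_) (filter-∈-sublists P? xs))
  ... | false = ∈-++⁺ˡ (filter-∈-sublists P? xs)

  ⊆-++ : ∀ {xs ys zs : List A} → xs ⊆ zs → ys ⊆ zs → xs ++ ys ⊆ zs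
  ⊆-++ {xs} p q = [ p , q ]′ ∘ ∈-++⁻ xs

  sublist-⊆ : ∀ (xs : List A) {ys} → ys ∈ sublists xs → ys ⊆ xs
  sublist-⊆ []       (here ≡.refl) = id
  sublist-⊆ (x ∷ xs) ys∈ with ∈-++⁻ (sublists xs) ys∈
  ... | inj₁ ys∈′ = there ∘ sublist-⊆ xs ys∈′
  ... | inj₂ ys∈′ with _ , zs∈ , ≡.refl ← ∈-map⁻ (x ∷_) ys∈′ = ⊆.∷⁺ʳ x (sublist-⊆ xs zs∈)

-- Q n x reads: x has been discarded after at most n rounds.
abstract
  prune : ∀ {A : Set} → DecidableEquality A → (xs : List A)
    (D : List A → A → Set) → (∀ ys x → Dec (D ys x)) →
    (Q : ℕ → A → Set) → (∀ {n x} → Q n x → Q (suc n) x) →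
    (∀ {n ys x} → ys ⊆ xs → (∀ {y} → y ∈ xs → y ∈ ys ⊎ Q n y) → x ∈ ys → D ys x → Q (suc n) x) →
    ∃₂ λ ys n → ys ⊆ xs × (∀ {y} → y ∈ xs → y ∈ ys ⊎ Q n y) × (∀ {y} → y ∈ ys → ¬ D ys y)
  prune {A} _≟_ xs D D? Q mono discard = loop xs 0 id inj₁ (<-wellFounded _)
    where
    loop : ∀ ys n → ys ⊆ xs → (∀ {y} → y ∈ xs → y ∈ ys ⊎ Q n y) → Acc _<_ (length ys) →
      ∃₂ λ ys n → ys ⊆ xs × (∀ {y} → y ∈ xs → y ∈ ys ⊎ Q n y) × (∀ {y} → y ∈ ys → ¬ D ys y)
    loop ys n ys⊆ inv (acc rec) with Any.any? (D? ys) ys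
    ... | no none = ys , n , ys⊆ , inv , λ y∈ d → none (Any.map (λ { ≡.refl → d }) y∈)
    ... | yes some with find some
    ...   | x , x∈ , d = loop (filter keep? ys) (suc n) (ys⊆ ∘ proj₁ ∘ ∈-filter⁻ keep?) inv′
                           (rec (List.filter-notAll keep? ys (Any.map (λ x≡y y≢x → y≢x (≡.sym x≡y)) x∈)))
      where
      keep? : Decidable (_≢ x)
      keep? y = ¬? (y ≟ x)
      inv′ : ∀ {y} → y ∈ xs → y ∈ filter keep? ys ⊎ Q (suc n) y
      inv′ {y} y∈ with inv y∈ | y ≟ x
      ... | inj₂ q   | _        = inj₂ (mono q)
      ... | inj₁ _   | yes ≡.refl = inj₂ (discard ys⊆ inv x∈ d)
      ... | inj₁ y∈′ | no y≢x   = inj₁ (∈-filter⁺ keep? y∈′ y≢x)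

-- Formulas

-- Uniform trees that carry the connective as a tag: equality is decided in four cases instead of
-- one per pair of connectives.
data Code (h : ℕ) : Set where
  leaf : Code h
  node : ℕ → ℕ → List (Fin h) → Code h → Code h → Code h

encode : ∀ {h} → Fm h → Code h
encode (pos p)  = node 0 p [] leaf leaf
encode (neg p)  = node 1 p [] leaf leaf
encode (A ∨' B) = node 2 0 [] (encode A) (encode B)
encode (A ∧' B) = node 3 0 [] (encode A) (encode B)
encode (◇ᵢ i A) = node 4 0 [ i ] (encode A) leaf
encode (□ᵢ i A) = node 5 0 [ i ] (encode A) leaf
encode (C̃ A)    = node 6 0 [] (encode A) leaf
encode (C A)    = node 7 0 [] (encode A) leaf

decode : ∀ {h} → Code h → Fm h
decode (node 0 p _ _ _)       = pos p
decode (node 1 p _ _ _)       = neg p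
decode (node 2 _ _ a b)       = decode a ∨' decode b
decode (node 3 _ _ a b)       = decode a ∧' decode b
decode (node 4 _ (i ∷ _) a _) = ◇ᵢ i (decode a)
decode (node 5 _ (i ∷ _) a _) = □ᵢ i (decode a)
decode (node 6 _ _ a _)       = C̃ (decode a)
decode (node 7 _ _ a _)       = C (decode a)
-- An arbitrary value: these trees are outside the image of `encode`.
decode _                      = pos 0

decode∘encode : ∀ {h} (A : Fm h) → decode (encode A) ≡ A
decode∘encode (pos p)  = ≡.refl
decode∘encode (neg p)  = ≡.refl
decode∘encode (A ∨' B) = cong₂ _∨'_ (decode∘encode A) (decode∘encode B)
decode∘encode (A ∧' B) = cong₂ _∧'_ (decode∘encode A) (decode∘encode B)
decode∘encode (◇ᵢ i A) = cong (◇ᵢ i) (decode∘encode A)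
decode∘encode (□ᵢ i A) = cong (□ᵢ i) (decode∘encode A)
decode∘encode (C̃ A)    = cong C̃ (decode∘encode A)
decode∘encode (C A)    = cong C (decode∘encode A)

_≟ᶜ_ : ∀ {h} → DecidableEquality (Code h)
leaf           ≟ᶜ leaf                = yes ≡.refl
leaf           ≟ᶜ node _ _ _ _ _      = no λ ()
node _ _ _ _ _ ≟ᶜ leaf                = no λ ()
node t p i a b ≟ᶜ node t′ p′ i′ a′ b′ =
  map′ (λ { (≡.refl , ≡.refl , ≡.refl , ≡.refl , ≡.refl) → ≡.refl })
       (λ { ≡.refl → ≡.refl , ≡.refl , ≡.refl , ≡.refl , ≡.refl })
       (t ℕ.≟ t′ ×-dec p ℕ.≟ p′ ×-dec List.≡-dec Fin._≟_ i i′ ×-dec a ≟ᶜ a′ ×-dec b ≟ᶜ b′)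

abstract
  _≟_ : ∀ {h} → DecidableEquality (Fm h)
  A ≟ B = map′ (λ eq → ≡.trans (≡.sym (decode∘encode A)) (≡.trans (cong decode eq) (decode∘encode B)))
               (cong encode) (encode A ≟ᶜ encode B)

-- The disjuncts of `◇ A` kept apart, so that unfolding `C̃ A` brings no new disjunction into the
-- closure.
◇s : ∀ {h} → Fm h → Seq h
◇s A = tabulate (λ i → ◇ᵢ i A)

-- A is equivalent to the conjunction, over the members L of cnf A, of the disjunctions of L.
cnf : ∀ {h} → Fm h → List (Seq h)
cnf (A ∨' B) = cartesianProductWith _++_ (cnf A) (cnf B)
cnf (A ∧' B) = cnf A ++ cnf B
-- Since `◇ A` entails `C̃ A`, adding its disjuncts preserves equivalence.
cnf (C̃ A)    = [ C̃ A ∷ ◇s A ]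
cnf A        = [ [ A ] ]

-- A Fischer-Ladner closure. It omits `◇ᵢ i (C̃ A)` because C̃-formulas are handed to successors
-- whole, and it leaves `C A` without unfoldings because that formula is treated by reachability.
closure : ∀ {h} → Fm h → Seq h
closure (pos p)  = [ pos p ]
closure (neg p)  = [ neg p ]
closure (A ∨' B) = (A ∨' B) ∷ closure A ++ closure B
closure (A ∧' B) = (A ∧' B) ∷ closure A ++ closure B
closure (◇ᵢ i A) = ◇ᵢ i A ∷ closure A
closure (□ᵢ i A) = □ᵢ i A ∷ closure A
closure (C̃ A)    = C̃ A ∷ ◇s A ++ closure A
closure (C A)    = C A ∷ closure A

self∈closure : ∀ {h} (A : Fm h) → A ∈ closure A
self∈closure (pos p)  = here ≡.refl
self∈closure (neg p)  = here ≡.refl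
self∈closure (A ∨' B) = here ≡.refl
self∈closure (A ∧' B) = here ≡.refl
self∈closure (◇ᵢ i A) = here ≡.refl
self∈closure (□ᵢ i A) = here ≡.refl
self∈closure (C̃ A)    = here ≡.refl
self∈closure (C A)    = here ≡.refl

closure-trans : ∀ {h} (A : Fm h) {B} → B ∈ closure A → closure B ⊆ closure A
closure-trans (pos p)  (here ≡.refl) = id
closure-trans (neg p)  (here ≡.refl) = id
closure-trans (A ∨' B) (here ≡.refl) = id
closure-trans (A ∧' B) (here ≡.refl) = id
closure-trans (◇ᵢ i A) (here ≡.refl) = id
closure-trans (□ᵢ i A) (here ≡.refl) = id
closure-trans (C̃ A)    (here ≡.refl) = id
closure-trans (C A)    (here ≡.refl) = id
closure-trans (A ∨' B) (there D∈) with ∈-++⁻ (closure A) D∈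
... | inj₁ D∈A = there ∘ ∈-++⁺ˡ ∘ closure-trans A D∈A
... | inj₂ D∈B = there ∘ ∈-++⁺ʳ (closure A) ∘ closure-trans B D∈B
closure-trans (A ∧' B) (there D∈) with ∈-++⁻ (closure A) D∈
... | inj₁ D∈A = there ∘ ∈-++⁺ˡ ∘ closure-trans A D∈A
... | inj₂ D∈B = there ∘ ∈-++⁺ʳ (closure A) ∘ closure-trans B D∈B
closure-trans (◇ᵢ i A) (there D∈)   = there ∘ closure-trans A D∈
closure-trans (□ᵢ i A) (there D∈)   = there ∘ closure-trans A D∈
closure-trans (C A)    (there D∈)   = there ∘ closure-trans A D∈
closure-trans (C̃ A)    (there D∈) with ∈-++⁻ (◇s A) D∈
... | inj₂ D∈A = there ∘ ∈-++⁺ʳ (◇s A) ∘ closure-trans A D∈A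
... | inj₁ D∈◇ with i , ≡.refl ← ∈-tabulate⁻ D∈◇ =
  ⊆.∈-∷⁺ʳ (there (∈-++⁺ˡ (∈-tabulate⁺ i))) (there ∘ ∈-++⁺ʳ (◇s A))

cnf⊆closure : ∀ {h} (A : Fm h) {L} → L ∈ cnf A → L ⊆ closure A
cnf⊆closure (A ∨' B) L∈ with _ , _ , L₁∈ , L₂∈ , ≡.refl ← ∈-cartesianProductWith⁻ _++_ (cnf A) (cnf B) L∈ =
  there ∘ ⊆.++⁺ (cnf⊆closure A L₁∈) (cnf⊆closure B L₂∈)
cnf⊆closure (A ∧' B) L∈ with ∈-++⁻ (cnf A) L∈
... | inj₁ L∈A = there ∘ ∈-++⁺ˡ ∘ cnf⊆closure A L∈A
... | inj₂ L∈B = there ∘ ∈-++⁺ʳ (closure A) ∘ cnf⊆closure B L∈B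
cnf⊆closure (C̃ A)    (here ≡.refl) = ⊆.++⁺ʳ [ C̃ A ] ∈-++⁺ˡ
cnf⊆closure (pos p)  (here ≡.refl) = id
cnf⊆closure (neg p)  (here ≡.refl) = id
cnf⊆closure (◇ᵢ i A) (here ≡.refl) = ⊆.∈-∷⁺ʳ (here ≡.refl) λ ()
cnf⊆closure (□ᵢ i A) (here ≡.refl) = ⊆.∈-∷⁺ʳ (here ≡.refl) λ ()
cnf⊆closure (C A)    (here ≡.refl) = ⊆.∈-∷⁺ʳ (here ≡.refl) λ ()

-- Completeness

-- Prov n T Δ says that every sequent which consists of Δ and of side formulas including T
-- has a proof of depth at most ω · n + k for some finite k.
record Calculus (m : ℕ) : Set₁ where
  field
    Prov : ℕ → Seq (suc m) → Seq (suc m) → Set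
    later : ∀ {n T Δ} → Prov n T Δ → Prov (suc n) T Δ
    weaken : ∀ {n T T′ Δ} → T ⊆ T′ → Prov n T Δ → Prov n T′ Δ
    discard : ∀ {n T A Δ} → Prov n T Δ → Prov n T (A ∷ Δ)
    store : ∀ {n T A Δ} → Prov n (A ∷ T) Δ → Prov n T (A ∷ Δ)
    -- Takes a stored formula back as principal. C̃-formulas are excluded since in `D_C` they may
    -- sit at an ancestor; `A` is barred from `X` since its occurrence is used up.
    select : ∀ {n T X A} → A ∈ T → (∀ {D} → A ≢ C̃ D) → (∀ {B} → B ∈ X → B ∈ T × B ≢ A) →
             Prov n X [ A ] → Prov n T []
    axiom : ∀ {n T p} → pos p ∈ T → neg p ∈ T → Prov n T []
    ∧-rule : ∀ {n T A B Δ} → Prov n T (A ∷ Δ) → Prov n T (B ∷ Δ) → Prov n T ((A ∧' B) ∷ Δ)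
    ∨-rule : ∀ {n T A B Δ} → Prov n T (A ∷ B ∷ Δ) → Prov n T ((A ∨' B) ∷ Δ)
    -- Of the side formulas, the premise keeps only `map C̃ E`. Uniqueness lets `Δ` and `E` be split
    -- off from a multiset known only to include `T`.
    □-rule : ∀ {n T i A Δ E} → Unique Δ → Unique E →
             (∀ {D} → D ∈ Δ → ◇ᵢ i D ∈ T) → (∀ {D} → D ∈ E → C̃ D ∈ T) →
             Prov n (map C̃ E) (Δ ++ [ A ]) → Prov n T [ □ᵢ i A ]
    -- The one inference that costs a further ω.
    C-rule : ∀ {n T A} → (∀ k → Prov n T [ □^ (suc k) A ]) → Prov (suc n) T [ C A ]
    C̃-rule : ∀ {n T A Δ} → C̃ A ∈ T → Prov n (◇s A ++ T) Δ → Prov n T Δ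

module Completeness {m : ℕ} (K : Calculus m) (root : Fm (suc m)) where
  open Calculus K
  open import Data.List.Membership.DecPropositional (_≟_ {suc m}) using (_∈?_)
  open import Data.List.Membership.DecPropositional (List.≡-dec (_≟_ {suc m})) using () renaming (_∈?_ to _∈ˢ?_)

  -- States as subsets of the closure, and the successor relation

  private
    State = Seq (suc m)

  -- Deduplicated so that `diamonds` and `eventualities`, which filter it, meet the uniqueness
  -- hypotheses of `□-rule`.
  universe : Seq (suc m)
  universe = deduplicate _≟_ (closure root)

  closed : ∀ {A} → A ∈ universe → closure A ⊆ universe
  closed A∈ = ∈-deduplicate⁺ _≟_ ∘ closure-trans root (∈-deduplicate⁻ _≟_ (closure root) A∈)

  states : List State
  states = sublists universe

  state⊆ : ∀ {T} → T ∈ states → T ⊆ universe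
  state⊆ = sublist-⊆ universe

  -- Falsifying all formulas of `T` then falsifies a conjunct of `A`, hence `A`, even when `A`
  -- itself is not a member of `T`.
  Covers : State → Fm (suc m) → Set
  Covers T A = Any (All (_∈ T)) (cnf A)

  covers? : ∀ T A → Dec (Covers T A)
  covers? T A = Any.any? (All.all? (_∈? T)) (cnf A)

  covers-⊆ : ∀ {T T′ A} → T ⊆ T′ → Covers T A → Covers T′ A
  covers-⊆ T⊆ = Any.map (All.map T⊆)

  diamonds : Fin (suc m) → State → Seq (suc m)
  diamonds i T = filter (λ D → ◇ᵢ i D ∈? T) universe

  eventualities : State → Seq (suc m)
  eventualities T = filter (λ D → C̃ D ∈? T) universe

  -- Where `◇ᵢ i D` fails, `D` fails at every i-successor; where `C̃ D` fails, it fails there again.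
  Succ : Fin (suc m) → State → State → Set
  Succ i T T′ = All (Covers T′) (diamonds i T) × All (Covers T′) (map C̃ (eventualities T))

  succ? : ∀ i T T′ → Dec (Succ i T T′)
  succ? i T T′ = All.all? (covers? T′) (diamonds i T) ×-dec All.all? (covers? T′) (map C̃ (eventualities T))

  succ-⊆ : ∀ {i T T′ T″} → T′ ⊆ T″ → Succ i T T′ → Succ i T T″
  succ-⊆ T′⊆ (p , q) = All.map (λ {A} → covers-⊆ {A = A} T′⊆) p , All.map (λ {A} → covers-⊆ {A = A} T′⊆) q

  ∈-diamonds : ∀ {i T D} → T ∈ states → ◇ᵢ i D ∈ T → D ∈ diamonds i T
  ∈-diamonds T∈ ◇D∈ = ∈-filter⁺ _ (closed (state⊆ T∈ ◇D∈) (there (self∈closure _))) ◇D∈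

  ∈-eventualities : ∀ {T D} → T ∈ states → C̃ D ∈ T → D ∈ eventualities T
  ∈-eventualities {D = D} T∈ C̃D∈ =
    ∈-filter⁺ _ (closed (state⊆ T∈ C̃D∈) (there (∈-++⁺ʳ (◇s D) (self∈closure D)))) C̃D∈

  -- Backward proof search between states

  expand : ∀ {n T Δ} A → (∀ {L} → L ∈ cnf A → Prov n (L ++ T) Δ) → Prov n T (A ∷ Δ)
  expand (pos p)  h = store (h (here ≡.refl))
  expand (neg p)  h = store (h (here ≡.refl))
  expand (◇ᵢ i A) h = store (h (here ≡.refl))
  expand (□ᵢ i A) h = store (h (here ≡.refl))
  expand (C A)    h = store (h (here ≡.refl))
  expand (C̃ A) h = store (C̃-rule (here ≡.refl)
    (weaken (⊆.∈-∷⁺ʳ (∈-++⁺ʳ (◇s A) (here ≡.refl)) (⊆.++⁺ʳ (◇s A) there)) (h (here ≡.refl))))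
  expand (A ∧' B) h = ∧-rule (expand A (h ∘ ∈-++⁺ˡ)) (expand B (h ∘ ∈-++⁺ʳ (cnf A)))
  expand {T = T} (A ∨' B) h = ∨-rule (expand A λ {L} L∈ → expand B λ {L′} L′∈ →
    weaken (⊆.⊆-trans (⊆.⊆-reflexive (List.++-assoc L L′ T)) (⊆.⊆-reflexive-↭ (↭.shifts L L′)))
      (h (∈-cartesianProductWith⁺ _++_ L∈ L′∈)))

  -- Each branch of the decomposition of `Δ` ends in a set of closure formulas, represented by the
  -- sublist of `universe` with the same members. `Θ` stays whole, as it may be a formula `□^ k A`
  -- outside the closure.
  saturate : ∀ {n X} Δ {Θ} → Δ ⊆ universe → X ⊆ universe →
    (∀ {T} → T ∈ states → X ⊆ T → All (Covers T) Δ → Prov n T Θ) → Prov n X (Δ ++ Θ)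
  saturate {X = X} [] Δ⊆ X⊆ h =
    weaken (proj₂ ∘ ∈-filter⁻ (_∈? X) {xs = universe})
      (h (filter-∈-sublists (_∈? X) universe) (λ A∈ → ∈-filter⁺ (_∈? X) (X⊆ A∈) A∈) [])
  saturate {X = X} (A ∷ Δ) Δ⊆ X⊆ h = expand A λ {L} L∈ →
    saturate Δ (Δ⊆ ∘ there) (⊆-++ (closed (Δ⊆ (here ≡.refl)) ∘ cnf⊆closure A L∈) X⊆) λ T∈ LX⊆T cov →
      h T∈ (LX⊆T ∘ ∈-++⁺ʳ L) (Any.map (λ { ≡.refl → All.tabulate (LX⊆T ∘ ∈-++⁺ˡ) }) L∈ ∷ cov)

  -- Covering `C̃ D` asks for `◇s D` besides `C̃ D` itself.
  unfold-eventualities : ∀ {n X Δ} E → (∀ {D} → D ∈ E → C̃ D ∈ X) →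
    Prov n (concatMap ◇s E ++ X) Δ → Prov n X Δ
  unfold-eventualities []      E⊆ d = d
  unfold-eventualities (D ∷ E) E⊆ d = unfold-eventualities E (E⊆ ∘ there)
    (C̃-rule (∈-++⁺ʳ (concatMap ◇s E) (E⊆ (here ≡.refl)))
      (weaken (⊆.⊆-reflexive (List.++-assoc (◇s D) (concatMap ◇s E) _)) d))

  -- The premise of the □-rule contains what an i-successor of `T` has to falsify, so saturating it
  -- gives states `T′` with `Succ i T T′`. `X` differs from `T` because the principal formula may
  -- have been taken out.
  modal-step : ∀ {n X T i A} → T ∈ states →
    (∀ {D} → ◇ᵢ i D ∈ T → ◇ᵢ i D ∈ X) → (∀ {D} → C̃ D ∈ T → C̃ D ∈ X) →
    (∀ {T′} → T′ ∈ states → Succ i T T′ → Prov n T′ [ A ]) → Prov n X [ □ᵢ i A ]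
  modal-step {n} {X} {T} {i} {A} T∈ ◇⊆ C̃⊆ h =
    □-rule (Unique.filter⁺ _ unique) (Unique.filter⁺ _ unique)
      (◇⊆ ∘ proj₂ ∘ ∈-filter⁻ _ {xs = universe}) (C̃⊆ ∘ proj₂ ∘ ∈-filter⁻ _ {xs = universe})
      (unfold-eventualities E (∈-map⁺ C̃)
        (saturate (diamonds i T) (proj₁ ∘ ∈-filter⁻ _) (⊆-++ ◇E⊆ C̃E⊆) λ {T′} T′∈ X⊆T′ cov →
          h T′∈ (cov , All.map⁺ (All.tabulate (λ D∈ → here (X⊆T′ (∈-++⁺ʳ (concatMap ◇s E) (∈-map⁺ C̃ D∈)) ∷
            All.tabulate (λ ◇D∈ → X⊆T′ (∈-++⁺ˡ (∈-concatMap⁺ ◇s (Any.map (λ { ≡.refl → ◇D∈ }) D∈))))))))))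
    where
    E = eventualities T
    unique = DecUnique.deduplicate-! _≟_ (closure root)
    C̃∈ : ∀ {D} → D ∈ E → C̃ D ∈ universe
    C̃∈ = state⊆ T∈ ∘ proj₂ ∘ ∈-filter⁻ _ {xs = universe}
    C̃E⊆ : map C̃ E ⊆ universe
    C̃E⊆ A∈ with D , D∈ , ≡.refl ← ∈-map⁻ C̃ A∈ = C̃∈ D∈
    ◇E⊆ : concatMap ◇s E ⊆ universe
    ◇E⊆ A∈ with D , D∈ , A∈◇ ← find (∈-concatMap⁻ ◇s A∈) = closed (C̃∈ D∈) (there (∈-++⁺ˡ A∈◇))

  -- Kripke models on sets of states, and reachability

  -- A set W of states is a Kripke model in which a state is meant to falsify all its formulas.
  model : List State → Model (suc m)
  model W = record
    { S = State
    ; R = λ i T T′ → T′ ∈ W × Succ i T T′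
    -- A member `neg p` has to fail, so `p` holds; every other atom is made false.
    ; V = λ p T → does (neg p ∈? T)
    }

  -- No element of `N` escapes exactly when the successors in `W` of elements of `N` lie in `N` and
  -- do not cover `A`.
  Escapes : List State → Fm (suc m) → List State → State → Set
  Escapes W A N T = ∃ λ i → Any (λ T′ → Succ i T T′ × (Covers T′ A ⊎ T′ ∉ N)) W

  escapes? : ∀ W A N T → Dec (Escapes W A N T)
  escapes? W A N T = Fin.any? λ i → Any.any? (λ T′ → succ? i T T′ ×-dec (covers? T′ A ⊎-dec ¬? (T′ ∈ˢ? N))) W

  Reaches : List State → Fm (suc m) → State → Set
  Reaches W A T = ∃ λ T′ → Reach (model W) T T′ × Covers T′ A

  -- Pruning gives evidence on both sides: a removed state carries a path for the semantic argument,
  -- and the rest is closed under successors, as the C-rule needs.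
  reachability : ∀ W A → ∃₂ λ N (_ : ℕ) → N ⊆ W × (∀ {T} → T ∈ W → T ∈ N ⊎ Reaches W A T) ×
    (∀ {T} → T ∈ N → ¬ Escapes W A N T)
  reachability W A = prune (List.≡-dec _≟_) W (Escapes W A) (escapes? W A) (λ _ → Reaches W A) id move
    where
    move : ∀ {N T} → N ⊆ W → (∀ {T′} → T′ ∈ W → T′ ∈ N ⊎ Reaches W A T′) → T ∈ N → Escapes W A N T → Reaches W A T
    move _ inv _ (i , e) with find e
    ... | T′ , T′∈ , s , inj₁ cov = T′ , one i (T′∈ , s) , cov
    ... | T′ , T′∈ , s , inj₂ T′∉ with inv T′∈
    ...   | inj₁ T′∈N           = contradiction T′∈N T′∉
    ...   | inj₂ (T″ , r , cov) = T″ , more i (T′∈ , s) r , cov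

  unreaching : List State → Fm (suc m) → List State
  unreaching W A = proj₁ (reachability W A)

  unreaching⊆ : ∀ {W A} → unreaching W A ⊆ W
  unreaching⊆ {W} {A} = proj₁ (proj₂ (proj₂ (reachability W A)))

  unreaching-or-reaches : ∀ {W A T} → T ∈ W → T ∈ unreaching W A ⊎ Reaches W A T
  unreaching-or-reaches {W} {A} = proj₁ (proj₂ (proj₂ (proj₂ (reachability W A))))

  unreaching-closed : ∀ {W A T} → T ∈ unreaching W A → ¬ Escapes W A (unreaching W A) T
  unreaching-closed {W} {A} = proj₂ (proj₂ (proj₂ (proj₂ (reachability W A))))

  -- Defects, and the provability of defective states

  Clash : State → Fm (suc m) → Set
  Clash T (pos p) = neg p ∈ T
  Clash T _       = ⊥

  clash? : ∀ T A → Dec (Clash T A)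
  clash? T (pos p)  = neg p ∈? T
  clash? T (neg _)  = no λ ()
  clash? T (_ ∨' _) = no λ ()
  clash? T (_ ∧' _) = no λ ()
  clash? T (◇ᵢ _ _) = no λ ()
  clash? T (□ᵢ _ _) = no λ ()
  clash? T (C̃ _)    = no λ ()
  clash? T (C _)    = no λ ()

  □-Defect C-Defect : List State → State → Fm (suc m) → Set
  □-Defect W T A = ∃ λ i → □ᵢ i A ∈ T × All (λ T′ → ¬ (Covers T′ A × Succ i T T′)) W
  C-Defect W T A = C A ∈ T × T ∈ unreaching W A

  Defect : List State → State → Set
  Defect W T = Any (Clash T) T ⊎ Any (□-Defect W T) universe ⊎ Any (C-Defect W T) universe

  defect? : ∀ W T → Dec (Defect W T)
  defect? W T = Any.any? (clash? T) T ⊎-dec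
    (Any.any? (λ A → Fin.any? λ i → □ᵢ i A ∈? T ×-dec All.all? (λ T′ → ¬? (covers? T′ A ×-dec succ? i T T′)) W) universe ⊎-dec
     Any.any? (λ A → C A ∈? T ×-dec T ∈ˢ? unreaching W A) universe)

  bigAnd-rule : ∀ {k n T Δ} (f : Fin (suc k) → Fm (suc m)) → (∀ i → Prov n T (f i ∷ Δ)) → Prov n T (bigAnd f ∷ Δ)
  bigAnd-rule {zero}  f h = h zero
  bigAnd-rule {suc k} f h = ∧-rule (h zero) (bigAnd-rule (f ∘ suc) (h ∘ suc))

  private
    _≢?_ : (B A : Fm (suc m)) → Dec (B ≢ A)
    B ≢? A = ¬? (B ≟ A)

  module _ {W : List State} {n : ℕ} (W⊆ : W ⊆ states)
    (inv : ∀ {T} → T ∈ states → T ∈ W ⊎ Prov n T []) where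

    -- A successor is either eliminated, hence provable, or again unreaching, so induction on `k`
    -- applies. The bound `n` is the same for all `k`, which keeps the C-rule at a cost of ω.
    unreaching⇒□^ : ∀ {A} → A ∈ universe → ∀ k {X T} → T ∈ unreaching W A →
      (∀ {i D} → ◇ᵢ i D ∈ T → ◇ᵢ i D ∈ X) → (∀ {D} → C̃ D ∈ T → C̃ D ∈ X) → Prov n X [ □^ (suc k) A ]
    unreaching⇒□^ {A} A∈ k {X} {T} T∈ ◇⊆ C̃⊆ =
      bigAnd-rule _ λ i → modal-step (W⊆ (unreaching⊆ {A = A} T∈)) ◇⊆ C̃⊆ (next k i)
      where
      next : ∀ k i {T′} → T′ ∈ states → Succ i T T′ → Prov n T′ [ □^ k A ]
      -- A state above `T′` that covers `A` is still a successor of `T`; its survival would let `T`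
      -- escape.
      next zero i T′∈ s = saturate [ A ] (λ { (here ≡.refl) → A∈ }) (state⊆ T′∈) covered
        where
        covered : ∀ {T″} → T″ ∈ states → _ ⊆ T″ → All (Covers T″) [ A ] → Prov n T″ []
        covered T″∈ T′⊆ (cov ∷ []) with inv T″∈
        ... | inj₂ d    = d
        ... | inj₁ T″∈W = contradiction (i , lose T″∈W (succ-⊆ T′⊆ s , inj₁ cov)) (unreaching-closed T∈)
      next (suc k) i {T′} T′∈ s with inv T′∈
      ... | inj₂ d = discard d
      ... | inj₁ T′∈W with T′ ∈ˢ? unreaching W A
      ...   | no T′∉N  = contradiction (i , lose T′∈W (s , inj₂ T′∉N)) (unreaching-closed T∈)
      ...   | yes T′∈N = unreaching⇒□^ A∈ k T′∈N id id

    defect⇒prov : ∀ {T} → T ∈ W → Defect W T → Prov (suc n) T []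
    defect⇒prov {T} T∈ (inj₁ clash) with find clash
    ... | pos p , p∈ , p̄∈ = axiom p∈ p̄∈
    defect⇒prov {T} T∈ (inj₂ (inj₁ □d)) with find □d
    -- The selection removes no ◇- or C̃-formula. `later` aligns the bound with that of a C-defect.
    ... | A , A∈ , i , □A∈ , none = later (select □A∈ (λ ()) (∈-filter⁻ (_≢? □ᵢ i A))
      (modal-step (W⊆ T∈) (λ ◇D∈ → ∈-filter⁺ _ ◇D∈ λ ()) (λ C̃D∈ → ∈-filter⁺ _ C̃D∈ λ ()) λ T′∈ s →
        saturate [ A ] (λ { (here ≡.refl) → A∈ }) (state⊆ T′∈) (covered s)))
      where
      covered : ∀ {T′ T″} → Succ i T T′ → T″ ∈ states → T′ ⊆ T″ → All (Covers T″) [ A ] → Prov n T″ []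
      covered s T″∈ T′⊆ (cov ∷ []) with inv T″∈
      ... | inj₂ d    = d
      ... | inj₁ T″∈W = contradiction (cov , succ-⊆ T′⊆ s) (All.lookup none T″∈W)
    defect⇒prov {T} T∈ (inj₂ (inj₂ Cd)) with find Cd
    ... | A , A∈ , CA∈ , T∈N = select CA∈ (λ ()) (∈-filter⁻ (_≢? C A))
      (C-rule λ k → unreaching⇒□^ A∈ k T∈N (λ ◇D∈ → ∈-filter⁺ _ ◇D∈ λ ()) (λ C̃D∈ → ∈-filter⁺ _ C̃D∈ λ ()))

  -- Defect-free sets of states as countermodels

  module _ {W : List State} (W⊆ : W ⊆ states) (sound : ∀ {T} → T ∈ W → ¬ Defect W T) where

    -- Every edge hands on `C̃ A` together with `◇s A`; at the last one, `◇ᵢ i A` makes the end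
    -- state cover `A`.
    covers-reach : ∀ {A T T′} → T ∈ W → C̃ A ∈ T → ◇s A ⊆ T → Reach (model W) T T′ → T′ ∈ W × Covers T′ A
    covers-reach {A} T∈ C̃A∈ ◇A⊆ (one i (T′∈ , ◇cov , _)) =
      T′∈ , All.lookup ◇cov (∈-diamonds {D = A} (W⊆ T∈) (◇A⊆ (∈-tabulate⁺ {f = λ j → ◇ᵢ j A} i)))
    covers-reach T∈ C̃A∈ ◇A⊆ (more i (T′∈ , _ , C̃cov) r)
      with All.lookup C̃cov (∈-map⁺ C̃ (∈-eventualities (W⊆ T∈) C̃A∈))
    ... | here (C̃A∈′ ∷ ◇A⊆′) = covers-reach T′∈ C̃A∈′ (All.lookup ◇A⊆′) r

    -- The truth lemma in dual form, by induction on `A`. The absence of clashes, □-defects and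
    -- C-defects settles the cases of positive atoms, `□ᵢ` and `C`.
    falsify : ∀ A {T} → T ∈ W → Covers T A → ¬ (_⊨_ (model W) T A)
    falsify (pos p) {T} T∈ (here (p∈ ∷ [])) with neg p ∈? T
    ... | yes p̄∈ = λ _ → sound T∈ (inj₁ (lose p∈ p̄∈))
    ... | no _   = λ ()
    falsify (neg p) {T} T∈ (here (p̄∈ ∷ [])) with neg p ∈? T
    ... | yes _  = λ ()
    ... | no p̄∉ = λ _ → p̄∉ p̄∈
    falsify (A ∨' B) T∈ cov ¬¬ with find cov
    ... | _ , L∈ , L⊆ with L₁ , _ , L₁∈ , L₂∈ , ≡.refl ← ∈-cartesianProductWith⁻ _++_ (cnf A) (cnf B) L∈ =
      ¬¬ (falsify A T∈ (lose L₁∈ (All.++⁻ˡ L₁ L⊆)) , falsify B T∈ (lose L₂∈ (All.++⁻ʳ L₁ L⊆)))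
    falsify (A ∧' B) T∈ cov (a , b) with Any.++⁻ (cnf A) cov
    ... | inj₁ covA = falsify A T∈ covA a
    ... | inj₂ covB = falsify B T∈ covB b
    falsify (◇ᵢ i A) T∈ (here (◇A∈ ∷ [])) ¬∀ = ¬∀ λ T′ (T′∈ , ◇cov , _) →
      falsify A T′∈ (All.lookup ◇cov (∈-diamonds (W⊆ T∈) ◇A∈))
    -- If `□ᵢ i A` held, no successor in `W` could cover `A`, which is a □-defect.
    falsify (□ᵢ i A) T∈ (here (□A∈ ∷ [])) all = sound T∈ (inj₂ (inj₁
      (lose (closed (state⊆ (W⊆ T∈) □A∈) (there (self∈closure A)))
        (i , □A∈ , All.tabulate λ T′∈ (cov , s) → falsify A T′∈ cov (all _ (T′∈ , s))))))
    falsify (C̃ A) T∈ (here (C̃A∈ ∷ ◇A⊆)) ¬∀ = ¬∀ λ T′ r →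
      let T′∈ , cov = covers-reach T∈ C̃A∈ (All.lookup ◇A⊆) r in falsify A T′∈ cov
    falsify (C A) {T} T∈ (here (CA∈ ∷ [])) all with unreaching-or-reaches {A = A} T∈
    ... | inj₁ T∈N = sound T∈ (inj₂ (inj₂ (lose (closed (state⊆ (W⊆ T∈) CA∈) (there (self∈closure A)))
                         (CA∈ , T∈N))))
    ... | inj₂ (T′ , r , cov) = falsify A (end∈ r) cov (all T′ r)
      where
      end∈ : ∀ {T T′} → Reach (model W) T T′ → T′ ∈ W
      end∈ (one _ (T′∈ , _)) = T′∈
      end∈ (more _ _ r)      = end∈ r

  -- Saturating `root` yields states that cover it: an eliminated one is provable, and a survivor
  -- would falsify `root`. The number `n` counts the rounds.
  complete : Valid root → ∃ λ n → Prov n [] [ root ]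
  complete valid with prune (List.≡-dec _≟_) states Defect defect? (λ n T → Prov n T []) later (λ W⊆ inv → defect⇒prov W⊆ inv)
  ... | W , n , W⊆ , inv , sound = n ,
    saturate [ root ] (λ { (here ≡.refl) → ∈-deduplicate⁺ _≟_ (self∈closure root) }) (λ ()) refute
    where
    refute : ∀ {T} → T ∈ states → [] ⊆ T → All (Covers T) [ root ] → Prov n T []
    refute T∈ _ (cov ∷ []) with inv T∈
    ... | inj₁ T∈W = ⊥-elim (falsify W⊆ sound root T∈W cov (valid (model W) _))
    ... | inj₂ d   = d

-- System G_C

GProvable : ∀ {m} → ℕ → Seq (suc m) → Set
GProvable n Γ = Σ (GPf Γ) λ d → Stage n (gdepth d)

module _ {m : ℕ} where

  -- Every rule has a permutation built in, so the last one absorbs `q` at the same depth.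
  gresp : ∀ {n} {Γ Γ′ : Seq (suc m)} → Γ′ ↭ Γ → GProvable n Γ → GProvable n Γ′
  gresp q (ax Δ p e , s)         = ax Δ p (↭-trans q e) , s
  gresp q (∧r Δ A B e d₁ d₂ , s) = ∧r Δ A B (↭-trans q e) d₁ d₂ , s
  gresp q (∨r Δ A B e d , s)     = ∨r Δ A B (↭-trans q e) d , s
  gresp q (□r Γ Δ Θ i A e d , s) = □r Γ Δ Θ i A (↭-trans q e) d , s
  gresp q (Cr Δ A e d , s)       = Cr Δ A (↭-trans q e) d , s
  gresp q (C̃r Δ A e d , s)       = C̃r Δ A (↭-trans q e) d , s

  gbigOr : ∀ {k n} (f : Fin (suc k) → Fm (suc m)) {Γ} → GProvable n (tabulate f ++ Γ) → GProvable n (bigOr f ∷ Γ)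
  gbigOr {zero}  f         d = d
  gbigOr {suc k} f {Γ = Γ} d =
    let d′ , s = gresp (swap _ _ ↭-refl) (gbigOr (f ∘ suc) (gresp (↭.shift (f zero) (tabulate (f ∘ suc)) Γ) d))
    in ∨r _ _ _ ↭-refl d′ , stage-suc s

  GC : Calculus m
  GC = record
    -- Quantifying over all `Γ` that include `T` builds weakening in.
    { Prov    = λ n T Δ → ∀ {Γ} → T ⊆ Γ → GProvable n (Δ ++ Γ)
    ; later   = λ h T⊆ → let d , s = h T⊆ in d , stage-mono s
    ; weaken  = λ T⊆T′ h T′⊆ → h (T′⊆ ∘ T⊆T′)
    ; discard = λ {_} {_} {A} {Δ} h T⊆ → gresp (↭-sym (↭.shift A Δ _)) (h (there ∘ T⊆))
    ; store   = λ {_} {_} {A} {Δ} h T⊆ → gresp (↭-sym (↭.shift A Δ _)) (h (⊆.∷⁺ʳ A T⊆))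
    ; select  = λ A∈ _ X⊆ h T⊆ →
        let _ , e = ∈⇒↭ (T⊆ A∈) in
        gresp e (h λ B∈ → let B∈T , B≢A = X⊆ B∈ in drop e B≢A (T⊆ B∈T))
    ; axiom   = λ p∈ p̄∈ T⊆ →
        let _ , e = ∈⇒↭ (T⊆ p∈)
            _ , e′ = ∈⇒↭ (drop e (λ ()) (T⊆ p̄∈))
        in ax _ _ (↭-trans e (prep _ e′)) , stage-zero
    ; ∧-rule  = λ h₁ h₂ T⊆ →
        let d₁ , s₁ = h₁ T⊆
            d₂ , s₂ = h₂ T⊆
        in ∧r _ _ _ ↭-refl d₁ d₂ , stage-sup2 (stage-suc s₁) (stage-suc s₂)
    ; ∨-rule  = λ h T⊆ → let d , s = h T⊆ in ∨r _ _ _ ↭-refl d , stage-suc s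
    ; □-rule  = box-rule
    ; C-rule  = λ h T⊆ → Cr _ _ ↭-refl (λ k → proj₁ (h k T⊆)) , stage-lim (λ k → stage-suc (proj₂ (h k T⊆)))
    ; C̃-rule  = λ {_} {_} {A} {Δ} C̃A∈ h {Γ} T⊆ →
        let Γ′ , e = ∈⇒↭ (T⊆ C̃A∈)
            e′ = ↭-trans (↭.++⁺ˡ Δ e) (↭.shift (C̃ A) Δ Γ′)
            d , s = gresp (swap _ _ ↭-refl) (gbigOr (λ i → ◇ᵢ i A)
                      (gresp (↭-trans (↭.++⁺ˡ (◇s A) (↭-sym e′)) (↭.shifts (◇s A) Δ)) (h (⊆.++⁺ʳ (◇s A) T⊆))))
        in C̃r _ A e′ d , stage-suc s
    }
    where
    drop : ∀ {A B : Fm (suc m)} {Γ Γ′} → Γ ↭ A ∷ Γ′ → B ≢ A → B ∈ Γ → B ∈ Γ′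
    drop e B≢A B∈ with ↭.∈-resp-↭ e B∈
    ... | here B≡A  = contradiction B≡A B≢A
    ... | there B∈′ = B∈′

    box-rule : ∀ {n T i A} {Δ E : Seq (suc m)} → Unique Δ → Unique E →
      (∀ {D} → D ∈ Δ → ◇ᵢ i D ∈ T) → (∀ {D} → D ∈ E → C̃ D ∈ T) →
      (∀ {Γ} → map C̃ E ⊆ Γ → GProvable n ((Δ ++ [ A ]) ++ Γ)) →
      ∀ {Γ} → T ⊆ Γ → GProvable n ([ □ᵢ i A ] ++ Γ)
    box-rule {i = i} {A} {Δ} {E} Δ! E! ◇⊆ C̃⊆ h {Γ} T⊆ =
      -- `Θ` collects what the rule discards, including further copies of the listed formulas.
      let Θ , e = unique-⊆⇒↭ (Unique.++⁺ (Unique.map⁺ (λ { ≡.refl → ≡.refl }) Δ!)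
                                           (Unique.map⁺ (λ { ≡.refl → ≡.refl }) E!) disjoint)
                             (⊆-++ ◇Δ⊆ C̃E⊆)
          d , s = gresp (↭-trans (↭.++⁺ˡ Δ (↭.++-comm (map C̃ E) [ A ])) (↭-reflexive (≡.sym (List.++-assoc Δ [ A ] (map C̃ E)))))
                        (h {map C̃ E} id)
      in □r Δ E Θ i A
           (↭-trans (prep _ e) (↭-trans (↭-sym (↭.shift (□ᵢ i A) (map (◇ᵢ i) Δ ++ map C̃ E) Θ))
             (↭-reflexive (List.++-assoc (map (◇ᵢ i) Δ) (map C̃ E) (□ᵢ i A ∷ Θ))))) d
         , stage-suc s
      where
      disjoint : ∀ {B} → B ∈ map (◇ᵢ i) Δ × B ∈ map C̃ E → ⊥
      disjoint (B∈◇ , B∈C̃) with ∈-map⁻ (◇ᵢ i) B∈◇ | ∈-map⁻ C̃ B∈C̃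
      ... | _ , _ , ≡.refl | _ , _ , ()
      ◇Δ⊆ : map (◇ᵢ i) Δ ⊆ Γ
      ◇Δ⊆ B∈ with _ , D∈ , ≡.refl ← ∈-map⁻ (◇ᵢ i) B∈ = T⊆ (◇⊆ D∈)
      C̃E⊆ : map C̃ E ⊆ Γ
      C̃E⊆ B∈ with _ , D∈ , ≡.refl ← ∈-map⁻ C̃ B∈ = T⊆ (C̃⊆ D∈)

-- System D_C

module _ {h : ℕ} where

  mutual
    ≈S-refl : ∀ {Γ : NSeq h} → Γ ≈S Γ
    ≈S-refl {[]}    = []
    ≈S-refl {x ∷ Γ} = cons ≈I-refl ≈S-refl

    ≈I-refl : ∀ {x : Item h} → x ≈I x
    ≈I-refl {fm A}    = fm
    ≈I-refl {box i Δ} = box ≈S-refl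

  mutual
    ≈S-sym : ∀ {Γ Δ : NSeq h} → Γ ≈S Δ → Δ ≈S Γ
    ≈S-sym []          = []
    ≈S-sym (cons p q)  = cons (≈I-sym p) (≈S-sym q)
    ≈S-sym swap        = swap
    ≈S-sym (trans p q) = trans (≈S-sym q) (≈S-sym p)

    ≈I-sym : ∀ {x y : Item h} → x ≈I y → y ≈I x
    ≈I-sym fm      = fm
    ≈I-sym (box p) = box (≈S-sym p)

  ↭⇒≈S : ∀ {Γ Δ : NSeq h} → Γ ↭ Δ → Γ ≈S Δ
  ↭⇒≈S refl         = ≈S-refl
  ↭⇒≈S (prep x p)   = cons ≈I-refl (↭⇒≈S p)
  ↭⇒≈S (swap x y p) = trans swap (cons ≈I-refl (cons ≈I-refl (↭⇒≈S p)))
  ↭⇒≈S (trans p q)  = trans (↭⇒≈S p) (↭⇒≈S q)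

  ++-≈S : ∀ (Γ : NSeq h) {Δ Δ′} → Δ ≈S Δ′ → (Γ ++ Δ) ≈S (Γ ++ Δ′)
  ++-≈S []      p = p
  ++-≈S (x ∷ Γ) p = cons ≈I-refl (++-≈S Γ p)

  plug-≈S : ∀ (c : Ctx h) {Δ Δ′} → Δ ≈S Δ′ → plug c Δ ≈S plug c Δ′
  plug-≈S (hole Γ)      p = ++-≈S Γ p
  plug-≈S (inBox Γ i c) p = ++-≈S Γ (cons (box (plug-≈S c p)) [])

  plug-↭ : ∀ (c : Ctx h) {Δ Δ′} → Δ ↭ Δ′ → plug c Δ ≈S plug c Δ′
  plug-↭ c = plug-≈S c ∘ ↭⇒≈S

  infixr 5 _⟫_
  _⟫_ : Ctx h → Ctx h → Ctx h
  hole Γ      ⟫ hole Δ      = hole (Γ ++ Δ)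
  hole Γ      ⟫ inBox Δ i c = inBox (Γ ++ Δ) i c
  inBox Γ i c ⟫ c′          = inBox Γ i (c ⟫ c′)

  plug-⟫ : ∀ (c c′ : Ctx h) {X} → plug (c ⟫ c′) X ≡ plug c (plug c′ X)
  plug-⟫ (hole Γ)      (hole Δ) {X}  = List.++-assoc Γ Δ X
  plug-⟫ (hole Γ)      (inBox Δ i c) = List.++-assoc Γ Δ _
  plug-⟫ (inBox Γ i c) c′            = cong (λ Y → Γ ++ (box i Y ∷ [])) (plug-⟫ c c′)

  -- Moves the siblings of a principal formula into the context, where the rules of `D_C` expect
  -- them.
  frame : Ctx h → NSeq h → Ctx h
  frame c Δ = c ⟫ hole Δ

  plug-frame : ∀ (c : Ctx h) X Δ → plug c (X ++ Δ) ≈S plug (frame c Δ) X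
  plug-frame c X Δ = subst (plug c (X ++ Δ) ≈S_) (≡.sym (plug-⟫ c (hole Δ))) (plug-↭ c (↭.++-comm X Δ))

  hole-node : Ctx h → NSeq h
  hole-node (hole Γ)      = Γ
  hole-node (inBox _ _ c) = hole-node c

  data OnPath (A : Fm h) : Ctx h → Set where
    hole  : ∀ {Γ} → fm A ∈ Γ → OnPath A (hole Γ)
    inBox : ∀ {Γ i c} → fm A ∈ Γ → OnPath A (inBox Γ i c)
    below : ∀ {Γ i c} → OnPath A c → OnPath A (inBox Γ i c)

  hole-onPath : ∀ {A} c → fm A ∈ hole-node c → OnPath A c
  hole-onPath (hole Γ)      A∈ = hole A∈
  hole-onPath (inBox _ _ c) A∈ = below (hole-onPath c A∈)

  onPath-⟫ : ∀ {A c} c′ → OnPath A c → OnPath A (c ⟫ c′)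
  onPath-⟫ (hole _)      (hole A∈)  = hole (∈-++⁺ˡ A∈)
  onPath-⟫ (inBox _ _ _) (hole A∈)  = inBox (∈-++⁺ˡ A∈)
  onPath-⟫ c′            (inBox A∈) = inBox A∈
  onPath-⟫ c′            (below o)  = below (onPath-⟫ c′ o)

  hole-node-frame : ∀ (c : Ctx h) Δ → hole-node (frame c Δ) ≡ hole-node c ++ Δ
  hole-node-frame (hole Γ)      Δ = ≡.refl
  hole-node-frame (inBox _ _ c) Δ = hole-node-frame c Δ

  -- A formula C̃ A can also be used from the ancestors of the node of the hole.
  Available : Fm h → Ctx h → Set
  Available A c = fm A ∈ hole-node c ⊎ ∃ (λ D → A ≡ C̃ D) × OnPath A c

  available-C̃ : ∀ {A c} → Available (C̃ A) c → OnPath (C̃ A) c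
  available-C̃ (inj₁ A∈)      = hole-onPath _ A∈
  available-C̃ (inj₂ (_ , o)) = o

  -- Compares only what `Available` depends on; it holds when formulas are added along the path.
  _⊑_ : Ctx h → Ctx h → Set
  c ⊑ c′ = ∀ {A} → (fm A ∈ hole-node c → fm A ∈ hole-node c′) × (OnPath A c → OnPath A c′)

  available-⊑ : ∀ {A c c′} → c ⊑ c′ → Available A c → Available A c′
  available-⊑ c⊑ (inj₁ A∈)      = inj₁ (proj₁ c⊑ A∈)
  available-⊑ c⊑ (inj₂ (e , o)) = inj₂ (e , proj₂ c⊑ o)

  ⊑-frame : ∀ (c : Ctx h) Δ → c ⊑ frame c Δ
  ⊑-frame c Δ = (λ A∈ → subst (_ ∈_) (≡.sym (hole-node-frame c Δ)) (∈-++⁺ˡ A∈)) , onPath-⟫ (hole Δ)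

  inBox-⊑ : ∀ {Γ Γ′ : NSeq h} {i c c′} → Γ ⊆ Γ′ → c ⊑ c′ → inBox Γ i c ⊑ inBox Γ′ i c′
  inBox-⊑ Γ⊆ c⊑ = proj₁ c⊑ , λ { (inBox A∈) → inBox (Γ⊆ A∈) ; (below o) → below (proj₂ c⊑ o) }

  -- One occurrence of `A` moves from the context to the hole to become principal; hence the
  -- exception for `B` equal to `A`.
  record Exposed (A : Fm h) (c : Ctx h) : Set where
    field
      rest         : Ctx h
      plug-rest    : ∀ X → plug c X ≈S plug rest (fm A ∷ X)
      rest-node    : ∀ {B} → B ≢ A → fm B ∈ hole-node c → fm B ∈ hole-node rest
      rest-onPath  : ∀ {B} → B ≢ A → OnPath B c → OnPath B rest

    rest-available : ∀ {B} → B ≢ A → Available B c → Available B rest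
    rest-available B≢A (inj₁ B∈)      = inj₁ (rest-node B≢A B∈)
    rest-available B≢A (inj₂ (e , o)) = inj₂ (e , rest-onPath B≢A o)

  expose : ∀ {A} c → fm A ∈ hole-node c → Exposed A c
  expose {A} (hole Γ) A∈ with Γ′ , e ← ∈⇒↭ A∈ = record
    { rest        = hole Γ′
    ; plug-rest   = λ X → ↭⇒≈S (↭-trans (↭.++⁺ʳ X e) (↭-sym (↭.shift (fm A) Γ′ X)))
    ; rest-node   = drop
    ; rest-onPath = λ { B≢A (hole B∈) → hole (drop B≢A B∈) }
    }
    where
    drop : ∀ {B} → B ≢ A → fm B ∈ Γ → fm B ∈ Γ′
    drop B≢A B∈ with ↭.∈-resp-↭ e B∈
    ... | here ≡.refl = contradiction ≡.refl B≢A
    ... | there B∈′   = B∈′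
  expose (inBox Γ i c) A∈ = record
    { rest        = inBox Γ i rest
    ; plug-rest   = λ X → ++-≈S Γ (cons (box (plug-rest X)) [])
    ; rest-node   = rest-node
    ; rest-onPath = λ { B≢A (inBox B∈) → inBox B∈ ; B≢A (below o) → below (rest-onPath B≢A o) }
    }
    where open Exposed (expose c A∈)

-- Derived rules of D_C

DProvable : ∀ {m} → ℕ → NSeq (suc m) → Set
DProvable n Γ = Σ (DPf Γ) λ d → Stage n (ddepth d)

module _ {m : ℕ} where

  dresp : ∀ {n} {Γ Γ′ : NSeq (suc m)} → Γ′ ≈S Γ → DProvable n Γ → DProvable n Γ′
  dresp q (ax c p e , s)         = ax c p (trans q e) , s
  dresp q (∧r c A B e d₁ d₂ , s) = ∧r c A B (trans q e) d₁ d₂ , s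
  dresp q (∨r c A B e d , s)     = ∨r c A B (trans q e) d , s
  dresp q (□r c i A e d , s)     = □r c i A (trans q e) d , s
  dresp q (◇r c i A Δ e d , s)   = ◇r c i A Δ (trans q e) d , s
  dresp q (Cr c A e d , s)       = Cr c A (trans q e) d , s
  dresp q (C̃r c A k e d , s)     = C̃r c A k (trans q e) d , s

  into-frame : ∀ {n} (c : Ctx (suc m)) X Δ → DProvable n (plug c (X ++ Δ)) → DProvable n (plug (frame c Δ) X)
  into-frame c X Δ = dresp (≈S-sym (plug-frame c X Δ))

  d∧ : ∀ {n} (c : Ctx (suc m)) {A B Δ} → DProvable n (plug c (fm A ∷ Δ)) → DProvable n (plug c (fm B ∷ Δ)) →
       DProvable n (plug c (fm (A ∧' B) ∷ Δ))
  d∧ c {A} {B} {Δ} h₁ h₂ =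
    let d₁ , s₁ = into-frame c [ fm A ] Δ h₁
        d₂ , s₂ = into-frame c [ fm B ] Δ h₂
    in ∧r (frame c Δ) A B (plug-frame c [ _ ] Δ) d₁ d₂ , stage-sup2 (stage-suc s₁) (stage-suc s₂)

  d∨ : ∀ {n} (c : Ctx (suc m)) {A B Δ} → DProvable n (plug c (fm A ∷ fm B ∷ Δ)) → DProvable n (plug c (fm (A ∨' B) ∷ Δ))
  d∨ c {A} {B} {Δ} h =
    let d , s = into-frame c (fm A ∷ fm B ∷ []) Δ h in ∨r (frame c Δ) A B (plug-frame c [ _ ] Δ) d , stage-suc s

  dbigOr : ∀ {k n} (c : Ctx (suc m)) (f : Fin (suc k) → Fm (suc m)) {Δ} →
    DProvable n (plug c (map fm (tabulate f) ++ Δ)) → DProvable n (plug c (fm (bigOr f) ∷ Δ))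
  dbigOr {zero}  c f d = d
  dbigOr {suc k} c f {Δ} d = d∨ c (dresp (plug-↭ c (swap _ _ ↭-refl)) (dbigOr c (f ∘ suc)
    (dresp (plug-↭ c (↭.shift (fm (f zero)) (map fm (tabulate (f ∘ suc))) Δ)) d)))

  d◇ : ∀ {n} (c : Ctx (suc m)) {i D Δ} → fm (◇ᵢ i D) ∈ hole-node c →
    DProvable n (plug c [ box i (fm D ∷ Δ) ]) → DProvable n (plug c [ box i Δ ])
  d◇ c {i} {D} {Δ} ◇D∈ h =
    let d , s = dresp (≈S-sym (plug-rest _)) h in ◇r rest i D Δ (plug-rest _) d , stage-suc s
    where open Exposed (expose c ◇D∈)

  d◇s : ∀ {n} (c : Ctx (suc m)) {i Δ} Γ → (∀ {D} → D ∈ Γ → fm (◇ᵢ i D) ∈ hole-node c) →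
    DProvable n (plug c [ box i (map fm Γ ++ Δ) ]) → DProvable n (plug c [ box i Δ ])
  d◇s c []      ◇∈ h = h
  d◇s c (D ∷ Γ) ◇∈ h = d◇s c Γ (◇∈ ∘ there) (d◇ c (◇∈ (here ≡.refl)) h)

  depth : Ctx (suc m) → ℕ
  depth (hole _)      = zero
  depth (inBox _ _ c) = suc (depth c)

  -- Each ◇ of ◇^ (1 + depth c) A except the last is spent on entering one box of c.
  push : ∀ {n} o (c : Ctx (suc m)) {A X} →
    (∀ {c′} → c ⊑ c′ → DProvable n (plug o (plug c′ (map fm (◇s A) ++ X)))) →
    DProvable n (plug o (fm (◇^ (suc (depth c)) A) ∷ plug c X))
  push o (hole Γ) {A} {X} h = dbigOr o (λ i → ◇ᵢ i A)
    (dresp (plug-↭ o (↭.shifts (map fm (◇s A)) Γ)) (h {hole Γ} (id , id)))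
  push {n} o (inBox Γ i c) {A} {X} h = dbigOr o (λ j → ◇ᵢ j B)
    (subst (DProvable n) (≡.trans (plug-⟫ o (hole Γ′)) (cong (plug o) (List.++-assoc (map fm (◇s B)) Γ _)))
      -- The disjunct for agent `i` puts `B` into the box, where it is pushed further with that box
      -- now part of `o`.
      (d◇ (o ⟫ hole Γ′) ◇B∈ (subst (DProvable n) (≡.trans (plug-⟫ o inner) (≡.sym (plug-⟫ o (hole Γ′))))
        (push (o ⟫ inner) c λ {c′} c⊑ → subst (DProvable n) (≡.sym (plug-⟫ o inner))
          -- All of `◇s B` stays behind in the node, so `h` has to accept contexts larger than the
          -- original one.
          (h {inBox Γ′ i c′} (inBox-⊑ (∈-++⁺ʳ (map fm (◇s B))) c⊑))))))
    where
    B = ◇^ (suc (depth c)) A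
    Γ′ = map fm (◇s B) ++ Γ
    inner = inBox Γ′ i (hole [])
    ◇B∈ : fm (◇ᵢ i B) ∈ hole-node (o ⟫ hole Γ′)
    ◇B∈ = subst (fm (◇ᵢ i B) ∈_) (≡.sym (hole-node-frame o Γ′))
      (∈-++⁺ʳ (hole-node o) (∈-++⁺ˡ (∈-map⁺ fm (∈-tabulate⁺ {f = λ j → ◇ᵢ j B} i))))

  -- The recursion moves boxes from `c` to `o` until the node holding `C̃ A` is the root of `c`;
  -- from there `push` reaches the hole.
  dC̃ : ∀ {n} o {c : Ctx (suc m)} {A X} → OnPath (C̃ A) c →
    (∀ {c′} → c ⊑ c′ → DProvable n (plug o (plug c′ (map fm (◇s A) ++ X)))) → DProvable n (plug o (plug c X))
  dC̃ {n} o {c} {A} {X} path h = go path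
    where
    at-root : fm (C̃ A) ∈ plug c X → DProvable n (plug o (plug c X))
    at-root C̃A∈ =
      let Z , e = ∈⇒↭ C̃A∈
          d , s = into-frame o (fm (C̃ A) ∷ fm (◇^ (suc (depth c)) A) ∷ []) Z
                    (dresp (plug-↭ o (↭-trans (swap _ _ ↭-refl) (prep _ (↭-sym e)))) (push o c h))
      -- The index counts from zero: `depth c` yields the power `suc (depth c)`, one ◇ per box and
      -- one for the hole.
      in C̃r (frame o Z) A (depth c) (trans (plug-↭ o e) (plug-frame o [ _ ] Z)) d , stage-suc s
    go : OnPath (C̃ A) c → DProvable n (plug o (plug c X))
    go (hole A∈)  = at-root (∈-++⁺ˡ A∈)
    go (inBox A∈) = at-root (∈-++⁺ˡ A∈)
    go (below {Γ} {i} path′) = subst (DProvable n) (plug-⟫ o inner)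
      (dC̃ (o ⟫ inner) path′ λ {c′} c⊑ → subst (DProvable n) (≡.sym (plug-⟫ o inner)) (h {inBox Γ i c′} (inBox-⊑ id c⊑)))
      where inner = inBox Γ i (hole [])

  DC : Calculus m
  DC = record
    { Prov    = DProv
    ; later   = λ h c T∈ → let d , s = h c T∈ in d , stage-mono s
    ; weaken  = λ T⊆T′ h c T′∈ → h c (T′∈ ∘ T⊆T′)
    ; discard = λ {_} {_} {A} {Δ} h c T∈ → out-of-frame c Δ (h (frame c [ fm A ]) (available-⊑ (⊑-frame c _) ∘ T∈))
    ; store   = λ {_} {_} {A} {Δ} h c T∈ → out-of-frame c Δ (h (frame c [ fm A ]) λ
        { (here ≡.refl) → inj₁ (subst (_ ∈_) (≡.sym (hole-node-frame c _)) (∈-++⁺ʳ (hole-node c) (here ≡.refl)))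
        ; (there B∈)    → available-⊑ (⊑-frame c _) (T∈ B∈) })
    ; select  = λ A∈ A≢C̃ X⊆ h c T∈ →
        let open Exposed (expose c (in-hole A≢C̃ (T∈ A∈))) in
        dresp (plug-rest []) (h rest λ B∈ → let B∈T , B≢A = X⊆ B∈ in rest-available B≢A (T∈ B∈T))
    ; axiom   = λ {_} {_} {p} p∈ p̄∈ c T∈ →
        let open Exposed (expose c (in-hole (λ ()) (T∈ p̄∈)))
            module E = Exposed (expose rest (rest-node (λ ()) (in-hole (λ ()) (T∈ p∈))))
        in ax E.rest p (trans (plug-rest []) (E.plug-rest _)) , stage-zero
    ; ∧-rule  = λ h₁ h₂ c T∈ → d∧ c (h₁ c T∈) (h₂ c T∈)
    ; ∨-rule  = λ h c T∈ → d∨ c (h c T∈)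
    ; □-rule  = box-rule
    ; C-rule  = λ h c T∈ → Cr c _ ≈S-refl (λ k → proj₁ (h k c T∈)) , stage-lim (λ k → stage-suc (proj₂ (h k c T∈)))
    ; C̃-rule  = λ {_} {_} {A} {Δ} C̃A∈ h c T∈ → dC̃ (hole []) (available-C̃ (T∈ C̃A∈)) λ {c′} c⊑ →
        dresp (trans (plug-↭ c′ (↭.++-comm (map fm (◇s A)) (map fm Δ))) (plug-frame c′ (map fm Δ) (map fm (◇s A))))
          (h (frame c′ (map fm (◇s A))) ([ stored c′ , available-⊑ (⊑-frame c′ _) ∘ available-⊑ c⊑ ∘ T∈ ]′ ∘ ∈-++⁻ (◇s A)))
    }
    where
    -- Ranging over all contexts builds weakening in and lets the premise of a □-rule live inside a
    -- new box.
    DProv : ℕ → Seq (suc m) → Seq (suc m) → Set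
    DProv n T Δ = ∀ c → (∀ {A} → A ∈ T → Available A c) → DProvable n (plug c (map fm Δ))

    out-of-frame : ∀ {n} c {A : Fm (suc m)} Δ →
      DProvable n (plug (frame c [ fm A ]) (map fm Δ)) → DProvable n (plug c (fm A ∷ map fm Δ))
    out-of-frame c {A} Δ = dresp (trans (plug-↭ c (↭.∷↭∷ʳ (fm A) (map fm Δ))) (plug-frame c (map fm Δ) [ fm A ]))

    in-hole : ∀ {A c} → (∀ {D} → A ≢ C̃ D) → Available A c → fm A ∈ hole-node c
    in-hole A≢C̃ (inj₁ A∈)            = A∈
    in-hole A≢C̃ (inj₂ ((_ , e) , _)) = contradiction e A≢C̃

    stored : ∀ c {Γ : Seq (suc m)} {A} → A ∈ Γ → Available A (frame c (map fm Γ))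
    stored c A∈ = inj₁ (subst (_ ∈_) (≡.sym (hole-node-frame c _)) (∈-++⁺ʳ (hole-node c) (∈-map⁺ fm A∈)))

    box-rule : ∀ {n T i A} {Δ E : Seq (suc m)} → Unique Δ → Unique E →
      (∀ {D} → D ∈ Δ → ◇ᵢ i D ∈ T) → (∀ {D} → D ∈ E → C̃ D ∈ T) →
      DProv n (map C̃ E) (Δ ++ [ A ]) → DProv n T [ □ᵢ i A ]
    box-rule {n} {i = i} {A} {Δ} {E} _ _ ◇⊆ C̃⊆ h c T∈ =
      let d , s = d◇s c Δ (in-hole (λ ()) ∘ T∈ ∘ ◇⊆)
                    (subst (DProvable n) (≡.trans (plug-⟫ c inner) (cong (λ Y → plug c [ box i Y ]) (List.map-++ fm Δ [ A ])))
                      (h (c ⟫ inner) carried))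
      in □r c i A ≈S-refl d , stage-suc s
      where
      inner = inBox [] i (hole [])
      carried : ∀ {B} → B ∈ map C̃ E → Available B (c ⟫ inner)
      carried B∈ with D , D∈ , ≡.refl ← ∈-map⁻ C̃ B∈ =
        -- The new box starts without side formulas; `C̃ D` is available there from its occurrence
        -- on the path.
        inj₂ ((D , ≡.refl) , onPath-⟫ inner (available-C̃ (T∈ (C̃⊆ D∈))))

theorem3p23 : (m : ℕ) (A : Fm (suc m)) → Valid A →
    (D⊢< φ 2 ozero ∣ A) × (G⊢< φ 2 ozero ∣ A)
theorem3p23 m A valid =
  let _ , hD = Completeness.complete DC A valid
      _ , hG = Completeness.complete GC A valid
      d , sd = hD (hole []) λ ()
      g , sg = hG {[]} λ ()
  in (d , stage-<φ₂0 sd) , (g , stage-<φ₂0 sg)
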